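{- The Bell triangle $X=[X_{n,k}]_{n,k\ge 0}$, the Catalan triangle of Aigner $C=[C_{n,k}]_{n,k\ge 0}$, and the Catalan triangle of Shapiro $B=[B_{n,k}]_{n,k\ge 0}$ are each TP.
   Context: A real (finite or infinite) matrix is TP (totally positive) if its minors of all orders are nonnegative. Each of the following is an infinite lower triangular matrix whose $(n,k)$ entry is $0$ unless $n\ge k\ge 0$, and whose $(0,0)$ entry is $1$; the recurrences hold for $n\ge 0$. Bell triangle: $X_{n+1,k}=X_{n,k-1}+(k+1)X_{n,k}+(k+1)X_{n,k+1}$ for $k\ge 0$. Catalan triangle of Aigner: $C_{n+1,0}=C_{n,0}+C_{n,1}$ and $C_{n+1,k}=C_{n,k-1}+2C_{n,k}+C_{n,k+1}$ for $k\ge 1$. Catalan triangle of Shapiro: $B_{n+1,k}=B_{n,k-1}+2B_{n,k}+B_{n,k+1}$ for $k\ge 0$. -}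

module Defs where

open import Algebra.Properties.Monoid.Sum using (sum)
open import Data.Fin.Base as Fin using (Fin; toℕ; punchIn)
open import Data.Integer.Base using (ℤ; +_; 0ℤ; 1ℤ; -1ℤ; _+_; _*_; _^_; _≤_)
open import Data.Integer.Properties using (+-0-monoid)
open import Data.Nat.Base as ℕ using (ℕ; zero; suc)
open import Relation.Binary.Core using (_Preserves_⟶_)

-- Laplace expansion along row 0; the determinant of the empty matrix is 1.
det : ∀ {m} → (Fin m → Fin m → ℤ) → ℤ
det {zero}  A = 1ℤ
det {suc m} A = sum +-0-monoid λ j →
  (-1ℤ ^ toℕ j) * A Fin.zero j * det (λ i l → A (Fin.suc i) (punchIn j l))

-- The agda-stdlib has no real numbers.  The matrices below have integer
-- entries, so their minors are integers and nonnegativity in ℤ and in ℝ agree.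
Matrix : Set
Matrix = ℕ → ℕ → ℤ

-- The minor of order m on the rows r 0 < r 1 < … and columns c 0 < c 1 < … .
minor : Matrix → ∀ {m} → (Fin m → ℕ) → (Fin m → ℕ) → ℤ
minor M r c = det λ i j → M (r i) (c j)

TotallyPositive : Matrix → Set
TotallyPositive M = ∀ {m} (r c : Fin m → ℕ) →
  r Preserves Fin._<_ ⟶ ℕ._<_ → c Preserves Fin._<_ ⟶ ℕ._<_ →
  0ℤ ≤ minor M r c

-- f (k - 1), with the convention that the entry at column -1 is 0.
at-pred : (ℕ → ℤ) → ℕ → ℤ
at-pred f zero    = 0ℤ
at-pred f (suc k) = f k

-- Row 0 of each triangle is (1, 0, 0, …); as the (n + 1 , k) entry depends
-- only on columns ≥ k - 1 of row n, the (n , k) entry then vanishes for n < k.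

bell : Matrix
bell zero    zero    = 1ℤ
bell zero    (suc k) = 0ℤ
bell (suc n) k       =
  at-pred (bell n) k + + suc k * bell n k + + suc k * bell n (suc k)

aigner : Matrix
aigner zero    zero    = 1ℤ
aigner zero    (suc k) = 0ℤ
aigner (suc n) zero    = aigner n 0 + aigner n 1
aigner (suc n) (suc k) =
  aigner n k + + 2 * aigner n (suc k) + aigner n (suc (suc k))

shapiro : Matrix
shapiro zero    zero    = 1ℤ
shapiro zero    (suc k) = 0ℤ
shapiro (suc n) k       =
  at-pred (shapiro n) k + + 2 * shapiro n k + shapiro n (suc k)

{-# OPTIONS --safe #-}
module Submission where

-- Why the triangles are totally positive.  Row 0 of each triangle is
-- (1, 0, 0, …), and row n + 1 is the image of row n under a fixed operator on
-- sequences.  The coefficient matrix of that operator is tridiagonal, and it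
-- factors into nonnegative bidiagonal matrices: with
--   (addNext a x) k = x k + a k * x (k + 1)
-- and at-pred shifting a sequence one place to the right, the operators are
--   bell     addNext 1 ∘ at-pred ∘ addNext (k ↦ k + 1),
--   aigner   addNext 1 ∘ at-pred ∘ addNext 1,
--   shapiro  addNext 1 ∘ addNext 1 ∘ at-pred.
--
-- Applied to every row of a matrix, each factor keeps all maximal minors
-- nonnegative (PreservesMinors).  For at-pred this is clear: a minor of the
-- new matrix is a minor of the old one or has a zero column.  For addNext the
-- columns are changed one at a time, in increasing order.  Adding a multiple
-- of column q + 1 to column q changes a minor only if it uses column q, and
-- then it adds a nonnegative multiple of the minor with q replaced by q + 1;
-- that one either has increasing columns again or has two equal adjacent
-- columns and vanishes.  The facts needed about det are that it is linear in
-- each column (det-linear) and zero if two adjacent columns agree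
-- (det-adjacent).
--
-- A minor of the triangle is then nonnegative by induction on its order and
-- on its first row r 0 (recursive⇒totallyPositive).  If r 0 = 0, Laplace
-- expansion along the row (1, 0, 0, …) leaves at most one minor of smaller
-- order.  If r 0 > 0, every row of the minor is the image under the operator
-- of the row above it, so the minor is nonnegative because the minors on the
-- rows r i - 1 are.

open import Defs
open import Algebra.Properties.Monoid.Sum using (sum)
open import Data.Fin.Base as Fin using (Fin; zero; suc; toℕ; punchIn; punchOut)
import Data.Fin.Properties as Fin
open import Data.Integer.Base using (ℤ; +_; 0ℤ; 1ℤ; -1ℤ; _+_; _*_; _^_; _≤_; +≤+)
open import Data.Integer.Properties
  using (+-0-monoid; ≤-refl; ≤-reflexive; +-mono-≤; *-monoˡ-≤-nonNeg;
         *-zeroʳ; *-identityˡ; +-*-semiring)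
open import Algebra.Properties.Semiring.Sum +-*-semiring
  using (sum-cong-≗; ∑-distrib-+; *-distribˡ-sum)
open import Data.Integer.Tactic.RingSolver using (solve-∀)
open import Data.Nat.Base as ℕ using (ℕ; zero; suc; z≤n; s≤s)
import Data.Nat.Properties as ℕ
open import Data.Product.Base using (_×_; _,_; ∃; ∃₂)
open import Data.Sum.Base using (_⊎_; inj₁; inj₂)
open import Data.Vec.Functional using (updateAt)
open import Data.Vec.Functional.Properties using (updateAt-updates; updateAt-minimal)
open import Function.Base using (_∘_; const)
open import Relation.Binary.Core using (_Preserves_⟶_)
open import Relation.Binary.Definitions using (tri<; tri≈; tri>)
open import Relation.Binary.PropositionalEquality.Core
  using (_≡_; _≢_; refl; sym; trans; cong; cong₂; subst)
open import Relation.Binary.PropositionalEquality.Properties using (module ≡-Reasoning)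
open import Relation.Nullary.Decidable using (yes; no)
open import Relation.Nullary.Negation using (contradiction)

private
  variable
    m n : ℕ

-- Nonnegative integers

sum-nonNeg : (f : Fin n → ℤ) → (∀ j → 0ℤ ≤ f j) → 0ℤ ≤ sum +-0-monoid f
sum-nonNeg {zero}  f f≥0 = ≤-refl
sum-nonNeg {suc n} f f≥0 = +-mono-≤ (f≥0 zero) (sum-nonNeg (f ∘ suc) (f≥0 ∘ suc))

sum-zero : (f : Fin n → ℤ) → (∀ j → f j ≡ 0ℤ) → sum +-0-monoid f ≡ 0ℤ
sum-zero {zero}  f f≡0 = refl
sum-zero {suc n} f f≡0 = cong₂ _+_ (f≡0 zero) (sum-zero (f ∘ suc) (f≡0 ∘ suc))

*-nonNeg : ∀ a {x} → 0ℤ ≤ x → 0ℤ ≤ + a * x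
*-nonNeg a {x} x≥0 = subst (_≤ + a * x) (*-zeroʳ (+ a)) (*-monoˡ-≤-nonNeg (+ a) x≥0)

-- Determinants

-- The j-th summand of det A.
laplaceTerm : (Fin (suc m) → Fin (suc m) → ℤ) → Fin (suc m) → ℤ
laplaceTerm A j =
  (-1ℤ ^ toℕ j) * A zero j * det (λ i l → A (suc i) (punchIn j l))

det-cong : {A B : Fin m → Fin m → ℤ} → (∀ i j → A i j ≡ B i j) → det A ≡ det B
det-cong {zero}  A≡B = refl
det-cong {suc m} A≡B = sum-cong-≗ λ j →
  cong₂ (λ x y → (-1ℤ ^ toℕ j) * x * y) (A≡B zero j)
    (det-cong λ i l → A≡B (suc i) (punchIn j l))

-- Linearity of det in column p.
det-linear : (A B C : Fin m → Fin m → ℤ) (a : ℤ) (p : Fin m) →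
  (∀ i → A i p ≡ B i p + a * C i p) →
  (∀ i l → l ≢ p → A i l ≡ B i l) →
  (∀ i l → l ≢ p → A i l ≡ C i l) →
  det A ≡ det B + a * det C
det-linear {suc m} A B C a p A≡B+aC A≡B A≡C = begin
  sum +-0-monoid (laplaceTerm A)
    ≡⟨ sum-cong-≗ term ⟩
  sum +-0-monoid (λ j → laplaceTerm B j + a * laplaceTerm C j)
    ≡⟨ ∑-distrib-+ (laplaceTerm B) (λ j → a * laplaceTerm C j) ⟩
  det B + sum +-0-monoid (λ j → a * laplaceTerm C j)
    ≡⟨ cong (_+_ (det B)) (*-distribˡ-sum a (laplaceTerm C)) ⟨
  det B + a * det C ∎
  where
  open ≡-Reasoning

  splitEntry : ∀ s x y a d → s * (x + a * y) * d ≡ s * x * d + a * (s * y * d)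
  splitEntry = solve-∀

  splitMinor : ∀ s x a d e → s * x * (d + a * e) ≡ s * x * d + a * (s * x * e)
  splitMinor = solve-∀

  term : ∀ j → laplaceTerm A j ≡ laplaceTerm B j + a * laplaceTerm C j
  term j with j Fin.≟ p
  ... | yes refl = begin
    s * A zero j * detOf A
      ≡⟨ cong (λ x → s * x * detOf A) (A≡B+aC zero) ⟩
    s * (B zero j + a * C zero j) * detOf A
      ≡⟨ splitEntry s (B zero j) (C zero j) a (detOf A) ⟩
    s * B zero j * detOf A + a * (s * C zero j * detOf A)
      ≡⟨ cong₂ (λ d e → s * B zero j * d + a * (s * C zero j * e))
           (det-cong λ i l → A≡B (suc i) (punchIn j l) (Fin.punchInᵢ≢i j l))
           (det-cong λ i l → A≡C (suc i) (punchIn j l) (Fin.punchInᵢ≢i j l)) ⟩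
    laplaceTerm B j + a * laplaceTerm C j ∎
    where
    s = -1ℤ ^ toℕ j
    detOf : (Fin (suc m) → Fin (suc m) → ℤ) → ℤ
    detOf M = det (λ i l → M (suc i) (punchIn j l))
  ... | no j≢p = begin
    s * A zero j * detOf A
      ≡⟨ cong (s * A zero j *_)
           (det-linear _ _ _ a (punchOut j≢p) atColumn
             (λ i l → A≡B (suc i) (punchIn j l) ∘ offColumn l)
             (λ i l → A≡C (suc i) (punchIn j l) ∘ offColumn l)) ⟩
    s * A zero j * (detOf B + a * detOf C)
      ≡⟨ splitMinor s (A zero j) a (detOf B) (detOf C) ⟩
    s * A zero j * detOf B + a * (s * A zero j * detOf C)
      ≡⟨ cong₂ (λ x y → s * x * detOf B + a * (s * y * detOf C))
           (A≡B zero j j≢p) (A≡C zero j j≢p) ⟩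
    laplaceTerm B j + a * laplaceTerm C j ∎
    where
    s = -1ℤ ^ toℕ j
    detOf : (Fin (suc m) → Fin (suc m) → ℤ) → ℤ
    detOf M = det (λ i l → M (suc i) (punchIn j l))

    p≡ : punchIn j (punchOut j≢p) ≡ p
    p≡ = Fin.punchIn-punchOut j≢p

    atColumn : ∀ i → A (suc i) (punchIn j (punchOut j≢p)) ≡
      B (suc i) (punchIn j (punchOut j≢p)) + a * C (suc i) (punchIn j (punchOut j≢p))
    atColumn i rewrite p≡ = A≡B+aC (suc i)

    offColumn : ∀ l → l ≢ punchOut j≢p → punchIn j l ≢ p
    offColumn l l≢ eq = l≢ (Fin.punchIn-injective j l _ (trans eq (sym p≡)))

det-zeroColumn : (A : Fin m → Fin m → ℤ) (p : Fin m) →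
  (∀ i → A i p ≡ 0ℤ) → det A ≡ 0ℤ
-- A column of zeros is itself minus itself, so det A = det A - det A.
det-zeroColumn A p Ap≡0 =
  trans (det-linear A A A -1ℤ p difference (λ _ _ _ → refl) (λ _ _ _ → refl))
    (self-cancel (det A))
  where
  difference : ∀ i → A i p ≡ A i p + -1ℤ * A i p
  difference i rewrite Ap≡0 i = refl
  self-cancel : ∀ d → d + -1ℤ * d ≡ 0ℤ
  self-cancel = solve-∀

-- Adjacent p q holds when q is the successor of p.
data Adjacent : Fin n → Fin n → Set where
  here  : Adjacent {suc (suc n)} zero (suc zero)
  there : {p q : Fin n} → Adjacent p q → Adjacent (suc p) (suc q)

adjacent-toℕ : {p q : Fin n} → Adjacent p q → toℕ q ≡ suc (toℕ p)
adjacent-toℕ here      = refl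
adjacent-toℕ (there a) = cong suc (adjacent-toℕ a)

adjacent-sum : {p q : Fin n} → Adjacent p q → (f : Fin n → ℤ) →
  f p + f q ≡ 0ℤ → (∀ j → j ≢ p → j ≢ q → f j ≡ 0ℤ) → sum +-0-monoid f ≡ 0ℤ
adjacent-sum here f fp+fq≡0 others = begin
  f zero + (f (suc zero) + rest)  ≡⟨ regroup (f zero) (f (suc zero)) rest ⟩
  (f zero + f (suc zero)) + rest  ≡⟨ cong₂ _+_ fp+fq≡0 (sum-zero _ λ j →
           others (suc (suc j)) (λ ()) (λ ())) ⟩
  0ℤ                              ∎
  where
  open ≡-Reasoning
  rest = sum +-0-monoid (λ j → f (suc (suc j)))
  regroup : ∀ x y z → x + (y + z) ≡ (x + y) + z
  regroup = solve-∀
adjacent-sum (there a) f fp+fq≡0 others =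
  cong₂ _+_ (others zero (λ ()) (λ ()))
    (adjacent-sum a (f ∘ suc) fp+fq≡0 λ j j≢p j≢q →
      others (suc j) (j≢p ∘ Fin.suc-injective) (j≢q ∘ Fin.suc-injective))

-- Deleting p or deleting q leaves the same columns, up to exchanging q and p.
adjacent-punchIn : {p q : Fin (suc n)} → Adjacent p q → ∀ l →
  punchIn p l ≡ punchIn q l ⊎ (punchIn p l ≡ q × punchIn q l ≡ p)
adjacent-punchIn here      zero    = inj₂ (refl , refl)
adjacent-punchIn here      (suc l) = inj₁ refl
adjacent-punchIn (there a) zero    = inj₁ refl
adjacent-punchIn (there a) (suc l) with adjacent-punchIn a l
... | inj₁ eq          = inj₁ (cong suc eq)
... | inj₂ (eq₁ , eq₂) = inj₂ (cong suc eq₁ , cong suc eq₂)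

-- Adjacent columns stay adjacent when some other column j is deleted.
adjacent-punchOut : {p q : Fin (suc n)} → Adjacent p q → ∀ j → j ≢ p → j ≢ q →
  ∃₂ λ p′ q′ → Adjacent p′ q′ × punchIn j p′ ≡ p × punchIn j q′ ≡ q
adjacent-punchOut here zero j≢p j≢q = contradiction refl j≢p
adjacent-punchOut here (suc zero) j≢p j≢q = contradiction refl j≢q
adjacent-punchOut {n = suc (suc n)} here (suc (suc j)) j≢p j≢q =
  zero , suc zero , here , refl , refl
adjacent-punchOut (there a) zero j≢p j≢q = _ , _ , a , refl , refl
adjacent-punchOut {n = suc n} (there a) (suc j) j≢p j≢q
  with p′ , q′ , a′ , eq₁ , eq₂ ←
    adjacent-punchOut a j (j≢p ∘ cong suc) (j≢q ∘ cong suc)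
  = suc p′ , suc q′ , there a′ , cong suc eq₁ , cong suc eq₂

det-adjacent : (A : Fin m → Fin m → ℤ) {p q : Fin m} → Adjacent p q →
  (∀ i → A i p ≡ A i q) → det A ≡ 0ℤ
det-adjacent {suc m} A {p} {q} adj Ap≡Aq =
  adjacent-sum adj (laplaceTerm A) cancel vanish
  where
  sameMinor : ∀ i l → A (suc i) (punchIn q l) ≡ A (suc i) (punchIn p l)
  sameMinor i l with adjacent-punchIn adj l
  ... | inj₁ eq          = cong (A (suc i)) (sym eq)
  ... | inj₂ (eq₁ , eq₂) =
    trans (cong (A (suc i)) eq₂) (trans (Ap≡Aq (suc i)) (cong (A (suc i)) (sym eq₁)))

  opposite : ∀ s x d → s * x * d + -1ℤ * s * x * d ≡ 0ℤ
  opposite = solve-∀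

  cancel : laplaceTerm A p + laplaceTerm A q ≡ 0ℤ
  cancel rewrite adjacent-toℕ adj | sym (Ap≡Aq zero) | det-cong sameMinor =
    opposite (-1ℤ ^ toℕ p) (A zero p) (det λ i l → A (suc i) (punchIn p l))

  vanish : ∀ j → j ≢ p → j ≢ q → laplaceTerm A j ≡ 0ℤ
  vanish j j≢p j≢q
    with p′ , q′ , adj′ , eq₁ , eq₂ ← adjacent-punchOut adj j j≢p j≢q
    = trans
        (cong ((-1ℤ ^ toℕ j) * A zero j *_)
          (det-adjacent _ adj′ λ i →
            trans (cong (A (suc i)) eq₁)
              (trans (Ap≡Aq (suc i)) (cong (A (suc i)) (sym eq₂)))))
        (*-zeroʳ ((-1ℤ ^ toℕ j) * A zero j))

-- Increasing column selections

-- Strictly increasing.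
Increasing : (Fin m → ℕ) → Set
Increasing c = c Preserves Fin._<_ ⟶ ℕ._<_

increasing-suc : {c : Fin (suc m) → ℕ} → Increasing c → Increasing (c ∘ suc)
increasing-suc inc i<j = inc (s≤s i<j)

increasing-head : (c : Fin (suc m) → ℕ) → Increasing c → ∀ j → c zero ℕ.≤ c j
increasing-head c inc zero    = ℕ.≤-refl
increasing-head c inc (suc j) = ℕ.<⇒≤ (inc (s≤s z≤n))

increasing-pred : {c : Fin m → ℕ} → Increasing c → (∀ j → c j ≢ 0) →
  Increasing (ℕ.pred ∘ c)
increasing-pred inc c≢0 {i} i<j = ℕ.pred-mono-< {{ℕ.≢-nonZero (c≢0 i)}} (inc i<j)

-- Consecutive values of an increasing selection sit at adjacent positions.
increasing-adjacent : (c : Fin m → ℕ) → Increasing c → ∀ p j →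
  c j ≡ suc (c p) → Adjacent p j
increasing-adjacent c inc p zero eq =
  contradiction (subst (ℕ._≤ c p) eq (increasing-head c inc p)) (ℕ.<-irrefl refl)
increasing-adjacent c inc zero (suc zero) eq = here
increasing-adjacent c inc zero (suc (suc j)) eq =
  contradiction (subst (suc (suc (c zero)) ℕ.≤_) eq
      (ℕ.≤-trans (s≤s (inc {zero} {suc zero} (s≤s z≤n)))
        (inc {suc zero} {suc (suc j)} (s≤s (s≤s z≤n)))))
    (ℕ.<-irrefl refl)
increasing-adjacent c inc (suc p) (suc j) eq =
  there (increasing-adjacent (c ∘ suc) (increasing-suc inc) p j eq)

bounded : (c : Fin m → ℕ) → ∃ λ N → ∀ j → c j ℕ.< N
bounded {zero}  c = 0 , λ ()
bounded {suc m} c with N , c<N ← bounded (c ∘ suc) =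
  suc (c zero) ℕ.⊔ N , λ where
    zero    → ℕ.m≤m⊔n (suc (c zero)) N
    (suc j) → ℕ.≤-trans (c<N j) (ℕ.m≤n⊔m (suc (c zero)) N)

-- Row operators that keep maximal minors nonnegative

-- All minors of maximal order m of a matrix with m rows are nonnegative.
-- Each row is an infinite sequence.
NonNegMinors : (Fin m → ℕ → ℤ) → Set
NonNegMinors R = ∀ c → Increasing c → 0ℤ ≤ det (λ i j → R i (c j))

PreservesMinors : ((ℕ → ℤ) → ℕ → ℤ) → Set
PreservesMinors T = ∀ {m} (R : Fin m → ℕ → ℤ) →
  NonNegMinors R → NonNegMinors (T ∘ R)

-- Adding a nonnegative multiple of column q + 1 to column q.
addColumn : (R R′ : Fin m → ℕ → ℤ) (a q : ℕ) →
  (∀ i → R′ i q ≡ R i q + + a * R i (suc q)) →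
  (∀ i k → k ≢ q → R′ i k ≡ R i k) →
  NonNegMinors R → NonNegMinors R′
addColumn {m} R R′ a q R′q R′k R≥0 c inc with Fin.any? (λ j → c j ℕ.≟ q)
... | no q∉c =
  subst (0ℤ ≤_) (sym (det-cong λ i j → R′k i (c j) (λ eq → q∉c (j , eq)))) (R≥0 c inc)
... | yes (p , refl) = subst (0ℤ ≤_) (sym split) (+-mono-≤ (R≥0 c inc) (*-nonNeg a replaced))
  where
  -- The selection c with its entry q = c p replaced by q + 1.
  c⁺ : Fin m → ℕ
  c⁺ = updateAt c p (const (suc q))

  c⁺-p : c⁺ p ≡ suc q
  c⁺-p = updateAt-updates p c

  c⁺-off : ∀ l → l ≢ p → c⁺ l ≡ c l
  c⁺-off l l≢p = updateAt-minimal l p c l≢p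

  c-injective : ∀ l → l ≢ p → c l ≢ c p
  c-injective l l≢p cl≡cp with Fin.<-cmp l p
  ... | tri< l<p _ _ = ℕ.<-irrefl cl≡cp (inc l<p)
  ... | tri≈ _ l≡p _ = l≢p l≡p
  ... | tri> _ _ p<l = ℕ.<-irrefl (sym cl≡cp) (inc p<l)

  split : det (λ i j → R′ i (c j)) ≡
          det (λ i j → R i (c j)) + + a * det (λ i j → R i (c⁺ j))
  split = det-linear _ _ _ (+ a) p
    (λ i → trans (R′q i) (cong (λ k → R i q + + a * R i k) (sym c⁺-p)))
    (λ i l l≢p → R′k i (c l) (c-injective l l≢p))
    (λ i l l≢p → trans (R′k i (c l) (c-injective l l≢p))
                       (cong (R i) (sym (c⁺-off l l≢p))))

  replaced : 0ℤ ≤ det (λ i j → R i (c⁺ j))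
  replaced with Fin.any? (λ j → c j ℕ.≟ suc q)
  ... | yes (j , cj≡) = ≤-reflexive (sym (det-adjacent _ adj λ i → cong (R i) c⁺p≡c⁺j))
    where
    adj : Adjacent p j
    adj = increasing-adjacent c inc p j cj≡

    j≢p : j ≢ p
    j≢p refl = ℕ.1+n≢n (sym cj≡)

    c⁺p≡c⁺j : c⁺ p ≡ c⁺ j
    c⁺p≡c⁺j = trans c⁺-p (sym (trans (c⁺-off j j≢p) cj≡))
  ... | no q+1∉c = R≥0 c⁺ inc⁺
    where
    inc⁺ : Increasing c⁺
    inc⁺ {i} {j} i<j with i Fin.≟ p | j Fin.≟ p
    ... | yes refl | yes refl = contradiction i<j (ℕ.<-irrefl refl)
    ... | yes refl | no j≢p rewrite c⁺-p | c⁺-off j j≢p =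
      ℕ.≤∧≢⇒< (inc i<j) (λ eq → q+1∉c (j , sym eq))
    ... | no i≢p | yes refl rewrite c⁺-p | c⁺-off i i≢p =
      ℕ.m<n⇒m<1+n (inc i<j)
    ... | no i≢p | no j≢p rewrite c⁺-off i i≢p | c⁺-off j j≢p = inc i<j

-- Right multiplication of the row vector x by the lower bidiagonal matrix with
-- ones on the diagonal and a k in position (k + 1 , k).  The coefficients are
-- natural numbers, so that they are nonnegative.
addNext : (ℕ → ℕ) → (ℕ → ℤ) → ℕ → ℤ
addNext a x k = x k + + a k * x (suc k)

-- The sequence that agrees with addNext a x at k < N and with x at k ≥ N.
addNextBelow : ℕ → (ℕ → ℕ) → (ℕ → ℤ) → ℕ → ℤ
addNextBelow zero    a x k       = x k
addNextBelow (suc N) a x zero    = addNext a x zero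
addNextBelow (suc N) a x (suc k) = addNextBelow N (a ∘ suc) (x ∘ suc) k

addNextBelow-updates : ∀ N a x → addNextBelow (suc N) a x N ≡
  addNextBelow N a x N + + a N * addNextBelow N a x (suc N)
addNextBelow-updates zero    a x = refl
addNextBelow-updates (suc N) a x = addNextBelow-updates N (a ∘ suc) (x ∘ suc)

addNextBelow-minimal : ∀ N a x k → k ≢ N →
  addNextBelow (suc N) a x k ≡ addNextBelow N a x k
addNextBelow-minimal zero    a x zero    k≢N = contradiction refl k≢N
addNextBelow-minimal zero    a x (suc k) k≢N = refl
addNextBelow-minimal (suc N) a x zero    k≢N = refl
addNextBelow-minimal (suc N) a x (suc k) k≢N =
  addNextBelow-minimal N (a ∘ suc) (x ∘ suc) k (k≢N ∘ cong suc)

addNextBelow-< : ∀ N a x k → k ℕ.< N → addNextBelow N a x k ≡ addNext a x k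
addNextBelow-< (suc N) a x zero    k<N       = refl
addNextBelow-< (suc N) a x (suc k) (s≤s k<N) =
  addNextBelow-< N (a ∘ suc) (x ∘ suc) k k<N

addNextBelow-preserves : ∀ a N → PreservesMinors (addNextBelow N a)
addNextBelow-preserves a zero    R R≥0 = R≥0
addNextBelow-preserves a (suc N) R R≥0 =
  addColumn (addNextBelow N a ∘ R) (addNextBelow (suc N) a ∘ R) (a N) N
    (λ i → addNextBelow-updates N a (R i))
    (λ i → addNextBelow-minimal N a (R i))
    (addNextBelow-preserves a N R R≥0)

addNext-preserves : ∀ a → PreservesMinors (addNext a)
addNext-preserves a R R≥0 c inc with N , c<N ← bounded c =
  subst (0ℤ ≤_) (det-cong λ i j → addNextBelow-< N a (R i) (c j) (c<N j))
    (addNextBelow-preserves a N R R≥0 c inc)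

at-pred-pred : ∀ x k → k ≢ 0 → at-pred x k ≡ x (ℕ.pred k)
at-pred-pred x zero    k≢0 = contradiction refl k≢0
at-pred-pred x (suc k) k≢0 = refl

at-pred-preserves : PreservesMinors at-pred
at-pred-preserves R R≥0 c inc with Fin.any? (λ j → c j ℕ.≟ 0)
... | yes (p , cp≡0) =
  ≤-reflexive (sym (det-zeroColumn _ p λ i → cong (at-pred (R i)) cp≡0))
... | no 0∉c =
  subst (0ℤ ≤_) (sym (det-cong λ i j → at-pred-pred (R i) (c j) (c≢0 j)))
    (R≥0 (ℕ.pred ∘ c) (increasing-pred inc c≢0))
  where
  c≢0 : ∀ j → c j ≢ 0
  c≢0 j cj≡0 = 0∉c (j , cj≡0)

∘-preserves : ∀ S T → PreservesMinors S → PreservesMinors T → PreservesMinors (S ∘ T)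
∘-preserves S T S-pres T-pres R R≥0 = S-pres (T ∘ R) (T-pres R R≥0)

-- Triangles generated by a row operator

-- M has row 0 equal to (1, 0, 0, …), and T sends each row to the next.
module _ (M : Matrix) (T : (ℕ → ℤ) → ℕ → ℤ) (T-preserves : PreservesMinors T)
  (corner : M 0 0 ≡ 1ℤ) (row₀ : ∀ k → M 0 (suc k) ≡ 0ℤ)
  (rows : ∀ n k → M (suc n) k ≡ T (M n) k) where

  private
    rows-pred : ∀ n k → n ≢ 0 → M n k ≡ T (M (ℕ.pred n)) k
    rows-pred zero    k n≢0 = contradiction refl n≢0
    rows-pred (suc n) k n≢0 = rows n k

    row₀-nonNeg : ∀ k → 0ℤ ≤ M 0 k
    row₀-nonNeg zero    = subst (0ℤ ≤_) (sym corner) (+≤+ z≤n)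
    row₀-nonNeg (suc k) = ≤-reflexive (sym (row₀ k))

  -- Induction on the order m, and for fixed m on the first row (byFirstRow).
  rowSelection-nonNegMinors : ∀ m (r : Fin m → ℕ) → Increasing r →
    NonNegMinors (M ∘ r)
  rowSelection-nonNegMinors zero r r-inc c c-inc = +≤+ z≤n
  rowSelection-nonNegMinors (suc m) r r-inc = byFirstRow (r zero) r r-inc refl
    where
    byFirstRow : ∀ n (r : Fin (suc m) → ℕ) → Increasing r → r zero ≡ n →
      NonNegMinors (M ∘ r)
    byFirstRow zero r r-inc r₀≡0 c c-inc = sum-nonNeg _ term
      where
      term : ∀ j → 0ℤ ≤ laplaceTerm (λ i j → M (r i) (c j)) j
      term zero rewrite r₀≡0 = nonNeg-product (row₀-nonNeg (c zero))
        (rowSelection-nonNegMinors m (r ∘ suc) (increasing-suc r-inc)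
          (c ∘ suc) (increasing-suc c-inc))
        where
        nonNeg-product : ∀ {x d} → 0ℤ ≤ x → 0ℤ ≤ d → 0ℤ ≤ 1ℤ * x * d
        nonNeg-product {+ x} {d} _ d≥0 =
          subst (λ y → 0ℤ ≤ y * d) (sym (*-identityˡ (+ x))) (*-nonNeg x d≥0)
      -- Every selected column after the first is positive, and there row 0
      -- is zero.
      term (suc j) rewrite r₀≡0 with c (suc j) | c-inc {zero} {suc j} (s≤s z≤n)
      ... | suc k | _ rewrite row₀ k | *-zeroʳ (-1ℤ ^ suc (toℕ j)) = ≤-refl
    byFirstRow (suc n) r r-inc r₀≡1+n c c-inc =
      subst (0ℤ ≤_) (sym (det-cong λ i j → rows-pred (r i) (c j) (r≢0 i)))
        (T-preserves (M ∘ ℕ.pred ∘ r)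
          (byFirstRow n (ℕ.pred ∘ r) (increasing-pred r-inc r≢0) (cong ℕ.pred r₀≡1+n))
          c c-inc)
      where
      r≢0 : ∀ i → r i ≢ 0
      r≢0 i = ℕ.m<n⇒n≢0 (subst (ℕ._≤ r i) r₀≡1+n (increasing-head r r-inc i))

  recursive⇒totallyPositive : TotallyPositive M
  recursive⇒totallyPositive r c r-inc c-inc =
    rowSelection-nonNegMinors _ r r-inc c c-inc

-- The three triangles

bell-totallyPositive : TotallyPositive bell
bell-totallyPositive = recursive⇒totallyPositive bell
  (addNext (const 1) ∘ at-pred ∘ addNext suc)
  (∘-preserves (addNext (const 1)) (at-pred ∘ addNext suc)
    (addNext-preserves (const 1))
    (∘-preserves at-pred (addNext suc)
      at-pred-preserves (addNext-preserves suc)))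
  refl (λ _ → refl)
  λ { n zero    → factor₀ (bell n 0) (bell n 1)
    ; n (suc k) → factor (+ suc k) (bell n k) (bell n (suc k)) (bell n (suc (suc k))) }
  where
  factor₀ : ∀ x y → 0ℤ + 1ℤ * x + 1ℤ * y ≡ 0ℤ + 1ℤ * (x + 1ℤ * y)
  factor₀ = solve-∀
  factor : ∀ a x y z →
    x + (1ℤ + a) * y + (1ℤ + a) * z ≡ (x + a * y) + 1ℤ * (y + (1ℤ + a) * z)
  factor = solve-∀

aigner-totallyPositive : TotallyPositive aigner
aigner-totallyPositive = recursive⇒totallyPositive aigner
  (addNext (const 1) ∘ at-pred ∘ addNext (const 1))
  (∘-preserves (addNext (const 1)) (at-pred ∘ addNext (const 1))
    (addNext-preserves (const 1))
    (∘-preserves at-pred (addNext (const 1))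
      at-pred-preserves (addNext-preserves (const 1))))
  refl (λ _ → refl)
  λ { n zero    → factor₀ (aigner n 0) (aigner n 1)
    ; n (suc k) → factor (aigner n k) (aigner n (suc k)) (aigner n (suc (suc k))) }
  where
  factor₀ : ∀ x y → x + y ≡ 0ℤ + 1ℤ * (x + 1ℤ * y)
  factor₀ = solve-∀
  factor : ∀ x y z → x + + 2 * y + z ≡ (x + 1ℤ * y) + 1ℤ * (y + 1ℤ * z)
  factor = solve-∀

shapiro-totallyPositive : TotallyPositive shapiro
shapiro-totallyPositive = recursive⇒totallyPositive shapiro
  (addNext (const 1) ∘ addNext (const 1) ∘ at-pred)
  (∘-preserves (addNext (const 1)) (addNext (const 1) ∘ at-pred)
    (addNext-preserves (const 1))
    (∘-preserves (addNext (const 1)) at-pred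
      (addNext-preserves (const 1)) at-pred-preserves))
  refl (λ _ → refl)
  λ n k → factor (at-pred (shapiro n) k) (shapiro n k) (shapiro n (suc k))
  where
  factor : ∀ x y z → x + + 2 * y + z ≡ (x + 1ℤ * y) + 1ℤ * (y + 1ℤ * z)
  factor = solve-∀

corollary2p12 : TotallyPositive bell × TotallyPositive aigner × TotallyPositive shapiro
corollary2p12 =
  bell-totallyPositive , aigner-totallyPositive , shapiro-totallyPositive
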